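{- Let $\Gamma$ be a graph with a vertex partition $\{C_1,C_2,C_3,D\}$ such that: (i) $|C_1|=|C_2|=|C_3|=2$; write $C_i=\{t_i,b_i\}$. (ii) For every vertex $v\in D$, the numbers of neighbours of $v$ in $C_1$, $C_2$ and $C_3$ are all congruent modulo $2$. (iii) The induced subgraph on $C_1\cup C_2\cup C_3$ has edge set $\{b_1b_2,\ b_2b_3,\ b_1b_3,\ b_1t_2,\ b_2t_3,\ b_3t_1\}$. Let $\pi$ be the permutation of $C_1\cup C_2\cup C_3$ with $\pi(t_i)=t_{i-1}$ and $\pi(b_i)=b_{i-1}$ (indices modulo $3$). Construct $\Gamma'$ from $\Gamma$ on the same vertex set as follows, leaving all other adjacencies unchanged: for every $v\in D$ that has exactly one neighbour $w$ in each $C_i$, replace each such edge $\{v,w\}$ by $\{v,\pi(w)\}$; and replace the induced subgraph on $C_1\cup C_2\cup C_3$ by the graph with edge set $\{b_1b_2,\ b_2b_3,\ b_1b_3,\ b_1t_3,\ b_2t_1,\ b_3t_2\}$. Then $\Gamma'$ is $\mathbb{R}$-cospectral with $\Gamma$.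
   Context: Graphs are finite, simple and loopless. Two graphs with adjacency matrices $A$ and $A'$ are $\mathbb{R}$-cospectral if $A+rJ$ and $A'+rJ$ have the same spectrum for every $r\in\mathbb{R}$, where $J$ is the all-ones matrix. -}

module Defs where

open import Algebra.Bundles using (CommutativeRing)
open import Data.Bool.Base using (Bool; true; false; if_then_else_)
import Data.Bool.Properties as Bool
open import Data.Empty using (⊥)
open import Data.Fin.Base using (Fin)
open import Data.Fin.Patterns using (0F; 1F; 2F)
import Data.Fin.Properties as Fin
open import Data.Fin.Subset using (Subset; _∈_; _∉_; _∩_; _∪_; ⁅_⁆; ∣_∣)
open import Data.Fin.Subset.Properties
  using (_∈?_; x∈⁅x⁆; p⊆p∪q; q⊆p∪q; ∪-idem; ∣⁅x⁆∣≡1)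
open import Data.List.Base using (List; []; _∷_)
import Data.List.Membership.Propositional as List
import Data.List.Membership.DecPropositional as DecList
open import Data.List.Relation.Unary.Any using (here; there)
open import Data.Nat.Base as ℕ using (ℕ)
import Data.Nat.DivMod as ℕ
import Data.Nat.Properties as ℕ
open import Data.Product.Base using (∃; _×_; _,_; proj₁; proj₂)
import Data.Product.Properties as Product
open import Data.Rational.Base as ℚ using (ℚ; 0ℚ; 1ℚ; ½)
import Data.Rational.Properties as ℚ
open import Data.Sum.Base using (_⊎_; inj₁; inj₂)
open import Data.Vec.Base using (tabulate)
open import Data.Vec.Functional using (Vector)
open import Function.Base using (_∘_)
open import Function.Bundles using (_⇔_; mk⇔)
open import Level using (Level; _⊔_; 0ℓ)
open import Relation.Binary.PropositionalEquality
  using (_≡_; _≢_; refl; sym; trans; cong; cong₂; subst)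
open import Relation.Nullary
  using (¬_; Dec; yes; no; does; contradiction; _⊎-dec_)
open import Relation.Nullary.Decidable using (dec-true; dec-false)

import Algebra.Properties.CommutativeSemigroup as CommutativeSemigroup
import Algebra.Properties.Group as Group
import Algebra.Properties.Monoid.Sum as MonoidSum

open CommutativeSemigroup
  (CommutativeRing.+-commutativeSemigroup ℚ.+-*-commutativeRing)
  using (interchange)
open Group ℚ.+-0-group using () renaming (⁻¹-involutive to neg-involutive)

-- Real numbers are Cauchy sequences of rationals; equality is a setoid relation.

record ℝ : Set where
  constructor mkℝ
  field
    seq    : ℕ → ℚ
    cauchy : ∀ ε → 0ℚ ℚ.< ε →
             ∃ λ N → ∀ m n → N ℕ.≤ m → N ℕ.≤ n →
             ℚ.∣ seq m ℚ.- seq n ∣ ℚ.< ε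

open ℝ public

infix 4 _≈ℝ_

record _≈ℝ_ (x y : ℝ) : Set where
  constructor mk≈
  field
    close : ∀ ε → 0ℚ ℚ.< ε →
            ∃ λ N → ∀ n → N ℕ.≤ n → ℚ.∣ seq x n ℚ.- seq y n ∣ ℚ.< ε

open _≈ℝ_ public

private

  -- A family indexed by a directed set, here measured by  size : I → ℕ .
  Null : {I : Set} → (I → ℕ) → (I → ℚ) → Set
  Null size f = ∀ ε → 0ℚ ℚ.< ε → ∃ λ N → ∀ i → N ℕ.≤ size i → ℚ.∣ f i ∣ ℚ.< ε

  Bounded : {I : Set} → (I → ℕ) → (I → ℚ) → Set
  Bounded size f =
    ∃ λ B → ℚ.Positive B × ∃ λ N → ∀ i → N ℕ.≤ size i → ℚ.∣ f i ∣ ℚ.≤ B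

  half-pos : ∀ ε → 0ℚ ℚ.< ε → 0ℚ ℚ.< ½ ℚ.* ε
  half-pos ε 0<ε = subst (ℚ._< ½ ℚ.* ε) (ℚ.*-zeroʳ ½) (ℚ.*-monoʳ-<-pos ½ 0<ε)

  halves : ∀ ε → ½ ℚ.* ε ℚ.+ ½ ℚ.* ε ≡ ε
  halves ε = trans (sym (ℚ.*-distribʳ-+ ε ½ ½)) (ℚ.*-identityˡ ε)

  module _ {I : Set} {size : I → ℕ} where

    null-≗ : ∀ {f g : I → ℚ} → (∀ i → f i ≡ g i) → Null size f → Null size g
    null-≗ eq nf ε 0<ε with nf ε 0<ε
    ... | N , p = N , λ i N≤i → subst (λ x → ℚ.∣ x ∣ ℚ.< ε) (eq i) (p i N≤i)

    null-0 : Null size (λ _ → 0ℚ)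
    null-0 ε 0<ε = 0 , λ _ _ → 0<ε

    null-neg : ∀ {f : I → ℚ} → Null size f → Null size (λ i → ℚ.- f i)
    null-neg {f} nf ε 0<ε with nf ε 0<ε
    ... | N , p = N , λ i N≤i →
      subst (ℚ._< ε) (sym (ℚ.∣-p∣≡∣p∣ (f i))) (p i N≤i)

    null-+ : ∀ {f g : I → ℚ} → Null size f → Null size g →
             Null size (λ i → f i ℚ.+ g i)
    null-+ {f} {g} nf ng ε 0<ε
      with nf (½ ℚ.* ε) (half-pos ε 0<ε) | ng (½ ℚ.* ε) (half-pos ε 0<ε)
    ... | M , p | N , q = M ℕ.⊔ N , λ i M⊔N≤i →
      ℚ.≤-<-trans (ℚ.∣p+q∣≤∣p∣+∣q∣ (f i) (g i))
        (subst (ℚ.∣ f i ∣ ℚ.+ ℚ.∣ g i ∣ ℚ.<_) (halves ε)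
          (ℚ.+-mono-< (p i (ℕ.m⊔n≤o⇒m≤o M N M⊔N≤i))
                      (q i (ℕ.m⊔n≤o⇒n≤o M N M⊔N≤i))))

    null-* : ∀ {f g : I → ℚ} → Bounded size f → Null size g →
             Null size (λ i → f i ℚ.* g i)
    null-* {f} {g} (B , B>0 , M , b) ng ε 0<ε = M ℕ.⊔ N , below
      where
      instance
        B-positive : ℚ.Positive B
        B-positive = B>0
        B-nonNegative : ℚ.NonNegative B
        B-nonNegative = ℚ.pos⇒nonNeg B
        B-nonZero : ℚ.NonZero B
        B-nonZero = ℚ.pos⇒nonZero B
        1/B-positive : ℚ.Positive (ℚ.1/ B)
        1/B-positive = ℚ.1/pos⇒pos B

      δ : ℚ
      δ = ℚ.1/ B ℚ.* ε

      0<δ : 0ℚ ℚ.< δ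
      0<δ = subst (ℚ._< δ) (ℚ.*-zeroʳ (ℚ.1/ B)) (ℚ.*-monoʳ-<-pos (ℚ.1/ B) 0<ε)

      N : ℕ
      N = proj₁ (ng δ 0<δ)

      Bδ≡ε : B ℚ.* δ ≡ ε
      Bδ≡ε = trans (sym (ℚ.*-assoc B (ℚ.1/ B) ε))
        (trans (cong (ℚ._* ε) (ℚ.*-inverseʳ B)) (ℚ.*-identityˡ ε))

      below : ∀ i → M ℕ.⊔ N ℕ.≤ size i → ℚ.∣ f i ℚ.* g i ∣ ℚ.< ε
      below i M⊔N≤i = subst (ℚ._< ε) (sym (ℚ.∣p*q∣≡∣p∣*∣q∣ (f i) (g i)))
        (ℚ.≤-<-trans
          (ℚ.*-monoʳ-≤-nonNeg ℚ.∣ g i ∣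
            {{ℚ.nonNegative (ℚ.0≤∣p∣ (g i))}}
            (b i (ℕ.m⊔n≤o⇒m≤o M N M⊔N≤i)))
          (subst (B ℚ.* ℚ.∣ g i ∣ ℚ.<_) Bδ≡ε
            (ℚ.*-monoʳ-<-pos B
              (proj₂ (ng δ 0<δ) i (ℕ.m⊔n≤o⇒n≤o M N M⊔N≤i)))))

  size₂ : ℕ × ℕ → ℕ
  size₂ (m , n) = m ℕ.⊓ n

  size₁ : ℕ → ℕ
  size₁ n = n

  Δ : (ℕ → ℚ) → ℕ × ℕ → ℚ
  Δ f (m , n) = f m ℚ.- f n

  ℝ⇒null : (x : ℝ) → Null size₂ (Δ (seq x))
  ℝ⇒null x ε 0<ε with cauchy x ε 0<ε
  ... | N , p = N , λ (m , n) N≤ →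
    p m n (ℕ.≤-trans N≤ (ℕ.m⊓n≤m m n)) (ℕ.≤-trans N≤ (ℕ.m⊓n≤n m n))

  null⇒ℝ : (f : ℕ → ℚ) → Null size₂ (Δ f) → ℝ
  null⇒ℝ f nf = mkℝ f λ ε 0<ε → proj₁ (nf ε 0<ε) , λ m n N≤m N≤n →
    proj₂ (nf ε 0<ε) (m , n) (ℕ.⊓-glb N≤m N≤n)

  bounded : (x : ℝ) → Bounded size₁ (seq x)
  bounded x with cauchy x 1ℚ (ℚ.positive⁻¹ 1ℚ)
  ... | N , p = ℚ.∣ a ∣ ℚ.+ 1ℚ , positive , N , λ n N≤n →
    ℚ.≤-trans
      (subst (λ z → ℚ.∣ z ∣ ℚ.≤ ℚ.∣ a ∣ ℚ.+ ℚ.∣ seq x n ℚ.- a ∣)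
        (cancel a (seq x n))
        (ℚ.∣p+q∣≤∣p∣+∣q∣ a (seq x n ℚ.- a)))
      (ℚ.+-monoʳ-≤ ℚ.∣ a ∣ (ℚ.<⇒≤ (p n N N≤n ℕ.≤-refl)))
    where
    a = seq x N

    positive : ℚ.Positive (ℚ.∣ a ∣ ℚ.+ 1ℚ)
    positive = ℚ.nonNeg+pos⇒pos ℚ.∣ a ∣ {{ℚ.nonNegative (ℚ.0≤∣p∣ a)}} 1ℚ

    cancel : ∀ p q → p ℚ.+ (q ℚ.- p) ≡ q
    cancel p q = trans (ℚ.+-comm p (q ℚ.- p)) (trans (ℚ.+-assoc q (ℚ.- p) p)
      (trans (cong (q ℚ.+_) (ℚ.+-inverseˡ p)) (ℚ.+-identityʳ q)))

  bounded-fst : (x : ℝ) → Bounded size₂ (seq x ∘ proj₁)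
  bounded-fst x with bounded x
  ... | B , B>0 , N , p = B , B>0 , N , λ (m , n) N≤ →
    p m (ℕ.≤-trans N≤ (ℕ.m⊓n≤m m n))

  bounded-snd : (x : ℝ) → Bounded size₂ (seq x ∘ proj₂)
  bounded-snd x with bounded x
  ... | B , B>0 , N , p = B , B>0 , N , λ (m , n) N≤ →
    p n (ℕ.≤-trans N≤ (ℕ.m⊓n≤n m n))

  Δ-+ : ∀ a b c d → (a ℚ.- b) ℚ.+ (c ℚ.- d) ≡ (a ℚ.+ c) ℚ.- (b ℚ.+ d)
  Δ-+ a b c d = trans (interchange a (ℚ.- b) c (ℚ.- d))
    (cong ((a ℚ.+ c) ℚ.+_) (sym (ℚ.neg-distrib-+ b d)))

  Δ-neg : ∀ a b → ℚ.- (a ℚ.- b) ≡ (ℚ.- a) ℚ.- (ℚ.- b)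
  Δ-neg a b = ℚ.neg-distrib-+ a (ℚ.- b)

  Δ-swap : ∀ a b → ℚ.- (a ℚ.- b) ≡ b ℚ.- a
  Δ-swap a b = trans (Δ-neg a b)
    (trans (cong ((ℚ.- a) ℚ.+_) (neg-involutive b)) (ℚ.+-comm (ℚ.- a) b))

  Δ-trans : ∀ a b c → (a ℚ.- b) ℚ.+ (b ℚ.- c) ≡ a ℚ.- c
  Δ-trans a b c = trans (ℚ.+-assoc a (ℚ.- b) (b ℚ.- c))
    (cong (a ℚ.+_) (trans (sym (ℚ.+-assoc (ℚ.- b) b (ℚ.- c)))
      (trans (cong (ℚ._- c) (ℚ.+-inverseˡ b)) (ℚ.+-identityˡ (ℚ.- c)))))

  *-distrib-Δ : ∀ a b c → a ℚ.* (b ℚ.- c) ≡ (a ℚ.* b) ℚ.- (a ℚ.* c)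
  *-distrib-Δ a b c = trans (ℚ.*-distribˡ-+ a b (ℚ.- c))
    (cong ((a ℚ.* b) ℚ.+_) (sym (ℚ.neg-distribʳ-* a c)))

  Δ-* : ∀ a b c d →
        a ℚ.* (c ℚ.- d) ℚ.+ d ℚ.* (a ℚ.- b) ≡ (a ℚ.* c) ℚ.- (b ℚ.* d)
  Δ-* a b c d = trans
    (cong₂ ℚ._+_ (*-distrib-Δ a c d)
      (trans (*-distrib-Δ d a b)
        (cong₂ ℚ._-_ (ℚ.*-comm d a) (ℚ.*-comm d b))))
    (Δ-trans (a ℚ.* c) (a ℚ.* d) (b ℚ.* d))

infixl 6 _+ℝ_
infixl 7 _*ℝ_
infix  8 -ℝ_

fromℚ : ℚ → ℝ
fromℚ q = null⇒ℝ (λ _ → q) (null-≗ (λ _ → sym (ℚ.+-inverseʳ q)) null-0)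

0ℝ 1ℝ : ℝ
0ℝ = fromℚ 0ℚ
1ℝ = fromℚ 1ℚ

_+ℝ_ : ℝ → ℝ → ℝ
x +ℝ y = null⇒ℝ (λ n → seq x n ℚ.+ seq y n)
  (null-≗ (λ (m , n) → Δ-+ (seq x m) (seq x n) (seq y m) (seq y n))
    (null-+ (ℝ⇒null x) (ℝ⇒null y)))

-ℝ_ : ℝ → ℝ
-ℝ x = null⇒ℝ (λ n → ℚ.- seq x n)
  (null-≗ (λ (m , n) → Δ-neg (seq x m) (seq x n)) (null-neg (ℝ⇒null x)))

_*ℝ_ : ℝ → ℝ → ℝ
x *ℝ y = null⇒ℝ (λ n → seq x n ℚ.* seq y n)
  (null-≗ (λ (m , n) → Δ-* (seq x m) (seq x n) (seq y m) (seq y n))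
    (null-+ (null-* (bounded-fst x) (ℝ⇒null y))
            (null-* (bounded-snd y) (ℝ⇒null x))))

private

  pointwise : ∀ {x y} → (∀ n → seq x n ≡ seq y n) → x ≈ℝ y
  pointwise {x} {y} eq = mk≈ (null-≗ {size = size₁}
    (λ n → sym (trans (cong (ℚ._- seq y n) (eq n)) (ℚ.+-inverseʳ (seq y n))))
    null-0)

  ≈-sym : ∀ {x y} → x ≈ℝ y → y ≈ℝ x
  ≈-sym {x} {y} (mk≈ p) = mk≈ (null-≗ {size = size₁}
    (λ n → Δ-swap (seq x n) (seq y n)) (null-neg p))

  ≈-trans : ∀ {x y z} → x ≈ℝ y → y ≈ℝ z → x ≈ℝ z
  ≈-trans {x} {y} {z} (mk≈ p) (mk≈ q) = mk≈ (null-≗ {size = size₁}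
    (λ n → Δ-trans (seq x n) (seq y n) (seq z n)) (null-+ p q))

  +-cong : ∀ {x y u v} → x ≈ℝ y → u ≈ℝ v → x +ℝ u ≈ℝ y +ℝ v
  +-cong {x} {y} {u} {v} (mk≈ p) (mk≈ q) = mk≈ (null-≗ {size = size₁}
    (λ n → Δ-+ (seq x n) (seq y n) (seq u n) (seq v n)) (null-+ p q))

  neg-cong : ∀ {x y} → x ≈ℝ y → -ℝ x ≈ℝ -ℝ y
  neg-cong {x} {y} (mk≈ p) = mk≈ (null-≗ {size = size₁}
    (λ n → Δ-neg (seq x n) (seq y n)) (null-neg p))

  *-cong : ∀ {x y u v} → x ≈ℝ y → u ≈ℝ v → x *ℝ u ≈ℝ y *ℝ v
  *-cong {x} {y} {u} {v} (mk≈ p) (mk≈ q) = mk≈ (null-≗ {size = size₁}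
    (λ n → Δ-* (seq x n) (seq y n) (seq u n) (seq v n))
    (null-+ (null-* (bounded x) q) (null-* (bounded v) p)))

ℝ-commutativeRing : CommutativeRing 0ℓ 0ℓ
ℝ-commutativeRing = record
  { Carrier = ℝ
  ; _≈_ = _≈ℝ_
  ; _+_ = _+ℝ_
  ; _*_ = _*ℝ_
  ; -_ = -ℝ_
  ; 0# = 0ℝ
  ; 1# = 1ℝ
  ; isCommutativeRing = record
    { isRing = record
      { +-isAbelianGroup = record
        { isGroup = record
          { isMonoid = record
            { isSemigroup = record
              { isMagma = record
                { isEquivalence = record
                  { refl = pointwise (λ _ → refl)
                  ; sym = ≈-sym
                  ; trans = ≈-trans
                  }
                ; ∙-cong = +-cong
                }
              ; assoc = λ x y z → pointwise λ n →
                  ℚ.+-assoc (seq x n) (seq y n) (seq z n)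
              }
            ; identity =
                (λ x → pointwise λ n → ℚ.+-identityˡ (seq x n))
              , (λ x → pointwise λ n → ℚ.+-identityʳ (seq x n))
            }
          ; inverse =
              (λ x → pointwise λ n → ℚ.+-inverseˡ (seq x n))
            , (λ x → pointwise λ n → ℚ.+-inverseʳ (seq x n))
          ; ⁻¹-cong = neg-cong
          }
        ; comm = λ x y → pointwise λ n → ℚ.+-comm (seq x n) (seq y n)
        }
      ; *-cong = *-cong
      ; *-assoc = λ x y z → pointwise λ n →
          ℚ.*-assoc (seq x n) (seq y n) (seq z n)
      ; *-identity =
          (λ x → pointwise λ n → ℚ.*-identityˡ (seq x n))
        , (λ x → pointwise λ n → ℚ.*-identityʳ (seq x n))
      ; distrib =
          (λ x y z → pointwise λ n →
            ℚ.*-distribˡ-+ (seq x n) (seq y n) (seq z n))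
        , (λ x y z → pointwise λ n →
            ℚ.*-distribʳ-+ (seq x n) (seq y n) (seq z n))
      }
    ; *-comm = λ x y → pointwise λ n → ℚ.*-comm (seq x n) (seq y n)
    }
  }

module Spectrum {c ℓ : Level} (R : CommutativeRing c ℓ) where

  open CommutativeRing R
  open MonoidSum +-monoid using (sum)

  Matrix : ℕ → Set c
  Matrix n = Fin n → Fin n → Carrier

  infixr 7 _·_

  _·_ : ∀ {n} → Matrix n → Vector Carrier n → Vector Carrier n
  (M · v) i = sum λ j → M i j * v j

  linearCombination : ∀ {k n} → Vector Carrier k →
                      Vector (Vector Carrier n) k → Vector Carrier n
  linearCombination cs vs i = sum λ j → cs j * vs j i

  InEigenspace : ∀ {n} → Matrix n → Carrier → Vector Carrier n → Set ℓ
  InEigenspace M μ v = ∀ i → (M · v) i ≈ μ * v i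

  -- The eigenspace of M for μ has a basis of k vectors.  Thus k = 0 says
  -- that μ is not an eigenvalue.
  record HasMultiplicity {n : ℕ} (M : Matrix n) (μ : Carrier) (k : ℕ)
                         : Set (c ⊔ ℓ) where
    field
      basis        : Vector (Vector Carrier n) k
      inEigenspace : ∀ j → InEigenspace M μ (basis j)
      independent  : ∀ cs → (∀ i → linearCombination cs basis i ≈ 0#) →
                     ∀ j → cs j ≈ 0#
      spanning     : ∀ v → InEigenspace M μ v →
                     ∃ λ cs → ∀ i → linearCombination cs basis i ≈ v i

  -- The spectrum is the collection of eigenvalues with multiplicities.
  -- This is used for real symmetric matrices only, for which all eigenvalues
  -- are real and geometric and algebraic multiplicities coincide.
  SameSpectrum : ∀ {n} → Matrix n → Matrix n → Set (c ⊔ ℓ)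
  SameSpectrum M M′ = ∀ μ k → HasMultiplicity M μ k ⇔ HasMultiplicity M′ μ k

open Spectrum ℝ-commutativeRing public

record Graph (n : ℕ) : Set where
  field
    adj    : Fin n → Fin n → Bool
    symm   : ∀ u v → adj u v ≡ adj v u
    irrefl : ∀ v → adj v v ≡ false

  Adjacent : Fin n → Fin n → Set
  Adjacent u v = adj u v ≡ true

  neighbours : Fin n → Subset n
  neighbours v = tabulate (adj v)

open Graph public

adjacencyMatrix : ∀ {n} → Graph n → Matrix n
adjacencyMatrix Γ u v = if adj Γ u v then 1ℝ else 0ℝ

-- M + r J is M + rJ for the all-ones matrix J.
_+_J : ∀ {n} → Matrix n → ℝ → Matrix n
(M + r J) u v = M u v +ℝ r *ℝ 1ℝ

RCospectral : ∀ {n} → Graph n → Graph n → Set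
RCospectral Γ Γ′ =
  ∀ r → SameSpectrum (adjacencyMatrix Γ + r J) (adjacencyMatrix Γ′ + r J)

-- The indices 1, 2, 3 modulo 3 become 0F, 1F, 2F.
prev : Fin 3 → Fin 3
prev 0F = 2F
prev 1F = 0F
prev 2F = 1F

-- {u,w} belongs to the set of unordered pairs listed by E.
_─_∈ᴱ_ : ∀ {n} → Fin n → Fin n → List (Fin n × Fin n) → Set
u ─ w ∈ᴱ E = (u , w) List.∈ E ⊎ (w , u) List.∈ E

InducedEdges : ∀ {n} → Graph n → (Fin n → Set) → List (Fin n × Fin n) → Set
InducedEdges Γ S E = ∀ {u w} → S u → S w → Adjacent Γ u w ⇔ u ─ w ∈ᴱ E

edges edges′ : ∀ {n} (t b : Fin 3 → Fin n) → List (Fin n × Fin n)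
edges t b =
  (b 0F , b 1F) ∷ (b 1F , b 2F) ∷ (b 0F , b 2F) ∷
  (b 0F , t 1F) ∷ (b 1F , t 2F) ∷ (b 2F , t 0F) ∷ []
edges′ t b =
  (b 0F , b 1F) ∷ (b 1F , b 2F) ∷ (b 0F , b 2F) ∷
  (b 0F , t 2F) ∷ (b 1F , t 0F) ∷ (b 2F , t 1F) ∷ []

record SwitchingPartition {n : ℕ} (Γ : Graph n) : Set where
  field
    C : Fin 3 → Subset n
    D : Subset n

    cover      : ∀ v → (∃ λ i → v ∈ C i) ⊎ v ∈ D
    C-disjoint : ∀ {i j v} → v ∈ C i → v ∈ C j → i ≡ j
    D-disjoint : ∀ {i v} → v ∈ C i → v ∉ D

    ∣C∣≡2 : ∀ i → ∣ C i ∣ ≡ 2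
    t b   : Fin 3 → Fin n
    C≡tb  : ∀ i → C i ≡ ⁅ t i ⁆ ∪ ⁅ b i ⁆

  numNeighbours : Fin n → Fin 3 → ℕ
  numNeighbours v i = ∣ neighbours Γ v ∩ C i ∣

  C₁∪C₂∪C₃ : Fin n → Set
  C₁∪C₂∪C₃ v = ∃ λ i → v ∈ C i

  field
    parity  : ∀ {v} → v ∈ D → ∀ i j →
              numNeighbours v i ℕ.% 2 ≡ numNeighbours v j ℕ.% 2
    induced : InducedEdges Γ C₁∪C₂∪C₃ (edges t b)

  OneNeighbourInEach : Fin n → Set
  OneNeighbourInEach v = ∀ i → numNeighbours v i ≡ 1

-- Γ′ is the graph constructed from Γ.  Replacing the edges {v,w} by {v,π(w)}
-- means that v is adjacent to π(w) in Γ′ iff it is adjacent to w in Γ.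
record IsSwitching {n : ℕ} {Γ : Graph n} (P : SwitchingPartition Γ)
                   (Γ′ : Graph n) : Set where
  open SwitchingPartition P
  field
    within-D  : ∀ {u v} → u ∈ D → v ∈ D → adj Γ′ u v ≡ adj Γ u v
    unchanged : ∀ {v} → v ∈ D → ¬ OneNeighbourInEach v →
                ∀ {w} → C₁∪C₂∪C₃ w → adj Γ′ v w ≡ adj Γ v w
    permuted  : ∀ {v} → v ∈ D → OneNeighbourInEach v → ∀ i →
                adj Γ′ v (t (prev i)) ≡ adj Γ v (t i) ×
                adj Γ′ v (b (prev i)) ≡ adj Γ v (b i)
    induced′  : InducedEdges Γ′ C₁∪C₂∪C₃ (edges′ t b)

-- The conditions determine Γ′ uniquely; here it is shown to exist.
module _ {n : ℕ} {Γ : Graph n} (P : SwitchingPartition Γ) where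

  open SwitchingPartition P

  private

    t∈C : ∀ i → t i ∈ C i
    t∈C i = subst (t i ∈_) (sym (C≡tb i)) (p⊆p∪q ⁅ b i ⁆ (x∈⁅x⁆ (t i)))

    b∈C : ∀ i → b i ∈ C i
    b∈C i = subst (b i ∈_) (sym (C≡tb i)) (q⊆p∪q ⁅ t i ⁆ ⁅ b i ⁆ (x∈⁅x⁆ (b i)))

    same-index : ∀ {i j u v} → u ∈ C i → v ∈ C j → u ≡ v → i ≡ j
    same-index u∈ v∈ refl = C-disjoint u∈ v∈

    t-injective : ∀ {i j} → t i ≡ t j → i ≡ j
    t-injective {i} {j} = same-index (t∈C i) (t∈C j)

    b-injective : ∀ {i j} → b i ≡ b j → i ≡ j
    b-injective {i} {j} = same-index (b∈C i) (b∈C j)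

    tᵢ≢bᵢ : ∀ i → t i ≢ b i
    tᵢ≢bᵢ i t≡b = contradiction (trans (sym (∣C∣≡2 i)) ∣C∣≡1) λ ()
      where
      ∣C∣≡1 : ∣ C i ∣ ≡ 1
      ∣C∣≡1 = trans (cong ∣_∣ (trans (C≡tb i)
        (trans (cong (λ x → ⁅ t i ⁆ ∪ ⁅ x ⁆) (sym t≡b)) (∪-idem ⁅ t i ⁆))))
        (∣⁅x⁆∣≡1 (t i))

    t≢b : ∀ i j → t i ≢ b j
    t≢b i j eq with refl ← same-index (t∈C i) (b∈C j) eq = tᵢ≢bᵢ i eq

    prev-injective : ∀ {i j} → prev i ≡ prev j → i ≡ j
    prev-injective {0F} {0F} _ = refl
    prev-injective {1F} {1F} _ = refl
    prev-injective {2F} {2F} _ = refl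
    prev-injective {0F} {1F} ()
    prev-injective {0F} {2F} ()
    prev-injective {1F} {0F} ()
    prev-injective {1F} {2F} ()
    prev-injective {2F} {0F} ()
    prev-injective {2F} {1F} ()

    π⁻¹ : Fin n → Fin n
    π⁻¹ x with Fin.any? (λ i → t (prev i) Fin.≟ x)
             | Fin.any? (λ i → b (prev i) Fin.≟ x)
    ... | yes (i , _) | _           = t i
    ... | no _        | yes (i , _) = b i
    ... | no _        | no _        = x

    π⁻¹-t : ∀ i → π⁻¹ (t (prev i)) ≡ t i
    π⁻¹-t i with Fin.any? (λ j → t (prev j) Fin.≟ t (prev i))
               | Fin.any? (λ j → b (prev j) Fin.≟ t (prev i))
    ... | yes (j , eq) | _ = cong t (prev-injective (t-injective eq))
    ... | no ¬p        | _ = contradiction (i , refl) ¬p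

    π⁻¹-b : ∀ i → π⁻¹ (b (prev i)) ≡ b i
    π⁻¹-b i with Fin.any? (λ j → t (prev j) Fin.≟ b (prev i))
               | Fin.any? (λ j → b (prev j) Fin.≟ b (prev i))
    ... | yes (j , eq) | _            = contradiction eq (t≢b _ _)
    ... | no _         | yes (j , eq) = cong b (prev-injective (b-injective eq))
    ... | no _         | no ¬p        = contradiction (i , refl) ¬p

    one? : ∀ v → Dec (OneNeighbourInEach v)
    one? v = Fin.all? λ i → numNeighbours v i ℕ.≟ 1

    listed? : ∀ u w → Dec ((u , w) List.∈ edges′ t b)
    listed? u w = DecList._∈?_ (Product.≡-dec Fin._≟_ Fin._≟_) (u , w) _

    edge? : ∀ u w → Dec (u ─ w ∈ᴱ edges′ t b)
    edge? u w = listed? u w ⊎-dec listed? w u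

    loopless : ∀ v → ¬ (v , v) List.∈ edges′ t b
    loopless v = λ
      { (here eq) → distinct (same eq) λ ()
      ; (there (here eq)) → distinct (same eq) λ ()
      ; (there (there (here eq))) → distinct (same eq) λ ()
      ; (there (there (there (here eq)))) → t≢b _ _ (sym (same eq))
      ; (there (there (there (there (here eq))))) → t≢b _ _ (sym (same eq))
      ; (there (there (there (there (there (here eq)))))) →
          t≢b _ _ (sym (same eq))
      }
      where
      same : ∀ {x y} → (v , v) ≡ (x , y) → x ≡ y
      same refl = refl
      distinct : ∀ {i j} → b i ≡ b j → i ≢ j → ⊥
      distinct eq i≢j = i≢j (b-injective eq)

    across : Fin n → Fin n → Bool
    across v x = if does (one? v) then adj Γ v (π⁻¹ x) else adj Γ v x

    adj′ : Fin n → Fin n → Bool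
    adj′ u w =
      if does (u ∈? D)
      then (if does (w ∈? D) then adj Γ u w else across u w)
      else (if does (w ∈? D) then across w u else does (edge? u w))

    symm′ : ∀ u w → adj′ u w ≡ adj′ w u
    symm′ u w with does (u ∈? D) | does (w ∈? D)
    ... | true  | true  = symm Γ u w
    ... | true  | false = refl
    ... | false | true  = refl
    ... | false | false = Bool.∨-comm (does (listed? u w)) (does (listed? w u))

    irrefl′ : ∀ v → adj′ v v ≡ false
    irrefl′ v with does (v ∈? D)
    ... | true  = irrefl Γ v
    ... | false = dec-false (edge? v v) λ
      { (inj₁ e) → loopless v e ; (inj₂ e) → loopless v e }

    C⇒∉D : ∀ {w} → C₁∪C₂∪C₃ w → w ∉ D
    C⇒∉D (i , w∈) = D-disjoint w∈

    adj′-across : ∀ {v w} → v ∈ D → C₁∪C₂∪C₃ w → adj′ v w ≡ across v w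
    adj′-across {v} {w} v∈D w∈C
      rewrite dec-true (v ∈? D) v∈D | dec-false (w ∈? D) (C⇒∉D w∈C) = refl

    across-one : ∀ {v} → OneNeighbourInEach v → ∀ x →
                 across v x ≡ adj Γ v (π⁻¹ x)
    across-one {v} one x rewrite dec-true (one? v) one = refl

    across-other : ∀ {v} → ¬ OneNeighbourInEach v → ∀ x →
                   across v x ≡ adj Γ v x
    across-other {v} ¬one x rewrite dec-false (one? v) ¬one = refl

    within : ∀ {u v} → u ∈ D → v ∈ D → adj′ u v ≡ adj Γ u v
    within {u} {v} u∈D v∈D
      rewrite dec-true (u ∈? D) u∈D | dec-true (v ∈? D) v∈D = refl

    adj′-edge : ∀ {u w} → C₁∪C₂∪C₃ u → C₁∪C₂∪C₃ w →
                adj′ u w ≡ does (edge? u w)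
    adj′-edge {u} {w} u∈C w∈C
      rewrite dec-false (u ∈? D) (C⇒∉D u∈C) | dec-false (w ∈? D) (C⇒∉D w∈C)
      = refl

    does⇔ : ∀ {A : Set} (a? : Dec A) {x : Bool} → x ≡ does a? → x ≡ true ⇔ A
    does⇔ (yes a) refl = mk⇔ (λ _ → a) (λ _ → refl)
    does⇔ (no ¬a) refl = mk⇔ (λ ()) (λ a → contradiction a ¬a)

  switch : Graph n
  switch = record { adj = adj′ ; symm = symm′ ; irrefl = irrefl′ }

  switch-isSwitching : IsSwitching P switch
  switch-isSwitching = record
    { within-D  = within
    ; unchanged = λ v∈D ¬one {w} w∈C →
        trans (adj′-across v∈D w∈C) (across-other ¬one w)
    ; permuted  = λ {v} v∈D one i →
        trans (adj′-across v∈D (_ , t∈C (prev i)))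
          (trans (across-one one _) (cong (adj Γ v) (π⁻¹-t i))) ,
        trans (adj′-across v∈D (_ , b∈C (prev i)))
          (trans (across-one one _) (cong (adj Γ v) (π⁻¹-b i)))
    ; induced′  = λ {u} {w} u∈C w∈C →
        does⇔ (edge? u w) (adj′-edge u∈C w∈C)
    }

{-# OPTIONS --safe #-}
-- Let φ exchange tᵢ and bᵢ, let σ be the cyclic shift tᵢ ↦ tᵢ₊₁, bᵢ ↦ bᵢ₊₁, both
-- the identity on D, and write φ and σ also for the matrices of x ↦ x ∘ φ and
-- x ↦ x ∘ σ.  They commute and φ² = 1, so Q = ½ (1 + φ + σ - φσ) has the inverse
-- Qᵀ = ½ (1 + φ + σ⁻¹ - φσ⁻¹).  The rows and columns of Q sum to 1, so Q J = J Q.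
-- Moreover Q A = A′ Q: Q fixes tᵢ + bᵢ and sends tᵢ - bᵢ to tᵢ₋₁ - bᵢ₋₁, so on the
-- neighbours of a vertex of D it acts as the switching does, namely trivially
-- on sums of the tᵢ + bᵢ, and as π when the i-th part is ½ (tᵢ + bᵢ) ± ½ (tᵢ - bᵢ);
-- the block on the Cᵢ is a finite check.  So Q maps the eigenspaces of A + rJ
-- onto those of A′ + rJ.
module Submission where

open import Algebra.Bundles using (CommutativeRing)
open import Data.Bool.Base using (Bool; true; false; not; if_then_else_; _xor_)
import Data.Bool.Properties as Bool
open import Data.Fin.Base using (Fin; zero; suc; _↑ˡ_; _↑ʳ_; splitAt; join)
open import Data.Fin.Patterns using (0F; 1F; 2F; 3F; 4F; 5F)
open import Data.Fin.Permutation using (permutation)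
open import Data.Fin.Properties using (_≟_; any?; all?; join-splitAt)
open import Data.Fin.Subset using (Subset; _∈_; _∩_; _∪_; ⁅_⁆; ∣_∣)
open import Data.Fin.Subset.Properties
  using (x∈⁅x⁆; x∈⁅y⁆⇒x≡y; x∈p∪q⁻; p⊆p∪q; q⊆p∪q; ∪-idem; ∪-identityˡ;
         ∪-identityʳ; ∩-zeroʳ; ∣⁅x⁆∣≡1; ∣⊥∣≡0)
import Data.List.Base as List
import Data.List.Membership.Propositional as List
import Data.List.Membership.Propositional.Properties as List
import Data.List.Membership.DecPropositional as DecList
open import Data.Nat.Base as ℕ using (ℕ)
import Data.Nat.Properties as ℕ
open import Data.Product.Base as Product using (∃; _,_; proj₁; proj₂)
import Data.Product.Properties as Product
open import Data.Rational.Base using (½)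
open import Data.Sum.Base using (_⊎_; inj₁; inj₂; [_,_]′)
import Data.Sum.Base as Sum
open import Data.Vec.Base using (_∷_; lookup)
open import Data.Vec.Properties using (lookup∘tabulate)
open import Data.Vec.Functional using (Vector)
open import Function.Base using (_∘_; id)
open import Function.Bundles using (_⇔_; mk⇔)
open import Function.Construct.Composition using (_⇔-∘_)
open import Function.Construct.Symmetry using (⇔-sym)
open import Function.Definitions using (Injective)
open import Level using (_⊔_)
open import Relation.Binary.PropositionalEquality as ≡
  using (_≡_; _≢_; _≗_; cong; cong₂; subst)
open import Relation.Nullary using (¬_; Dec; yes; no; does; contradiction; _⊎-dec_)
open import Relation.Nullary.Decidable using (from-yes)
open import Defs

-- Similarity of matrices and equality of spectra.

module Similarity {c ℓ} (R : CommutativeRing c ℓ) where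

  open CommutativeRing R
  open import Algebra.Properties.Monoid.Sum +-monoid using (sum; sum-cong-≋)
  open import Relation.Binary.Reasoning.Setoid setoid
  private module S = Spectrum R

  -- Additivity is stated for whole linear combinations, the form in which bases and matrix-vector
  -- products are pushed through `F`.
  record IsLinear {n} (F : Vector Carrier n → Vector Carrier n) : Set (c ⊔ ℓ) where
    field
      F-cong : ∀ {x y} → (∀ i → x i ≈ y i) → ∀ i → F x i ≈ F y i
      *-homo : ∀ a x i → F (λ j → a * x j) i ≈ a * F x i
      linearCombination-homo : ∀ {k} (cs : Vector Carrier k) vs i →
        F (S.linearCombination cs vs) i ≈ S.linearCombination cs (F ∘ vs) i

  record Similar {n} (M M′ : S.Matrix n) : Set (c ⊔ ℓ) where
    field
      F G         : Vector Carrier n → Vector Carrier n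
      F-isLinear  : IsLinear F
      G-isLinear  : IsLinear G
      F∘G         : ∀ x i → F (G x) i ≈ x i
      G∘F         : ∀ x i → G (F x) i ≈ x i
      intertwines : ∀ x i → F (M S.· x) i ≈ (M′ S.· F x) i

  ·-cong : ∀ {n} (M : S.Matrix n) {x y} → (∀ i → x i ≈ y i) →
           ∀ i → (M S.· x) i ≈ (M S.· y) i
  ·-cong M x≈y i = sum-cong-≋ λ j → *-congˡ (x≈y j)

  -- Since `G` is inverse to `F`, G M′ = G M′ F G = G F M G = M G.
  similar-sym : ∀ {n} {M M′ : S.Matrix n} → Similar M M′ → Similar M′ M
  similar-sym {M = M} {M′} sim = record
    { F = G ; G = F
    ; F-isLinear = G-isLinear ; G-isLinear = F-isLinear
    ; F∘G = G∘F ; G∘F = F∘G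
    ; intertwines = λ x i → begin
        G (M′ S.· x) i         ≈⟨ G.F-cong (·-cong M′ λ j → sym (F∘G x j)) i ⟩
        G (M′ S.· F (G x)) i   ≈⟨ G.F-cong (λ j → sym (intertwines (G x) j)) i ⟩
        G (F (M S.· G x)) i    ≈⟨ G∘F _ i ⟩
        (M S.· G x) i          ∎
    }
    where
    open Similar sim
    module G = IsLinear G-isLinear

  module _ {n} {M M′ : S.Matrix n} (sim : Similar M M′) where

    open Similar sim
    private
      module F = IsLinear F-isLinear
      module G = IsLinear G-isLinear

    inEigenspace-map : ∀ {μ v} → S.InEigenspace M μ v → S.InEigenspace M′ μ (F v)
    inEigenspace-map {μ} {v} v∈ i = begin
      (M′ S.· F v) i       ≈⟨ intertwines v i ⟨
      F (M S.· v) i        ≈⟨ F.F-cong v∈ i ⟩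
      F (λ j → μ * v j) i  ≈⟨ F.*-homo μ v i ⟩
      μ * F v i            ∎

    linearCombination-zero : ∀ {k} (cs : Vector Carrier k) vs →
      (∀ i → S.linearCombination cs (F ∘ vs) i ≈ 0#) →
      ∀ i → S.linearCombination cs vs i ≈ 0#
    linearCombination-zero cs vs ≈0 i = begin
      S.linearCombination cs vs i          ≈⟨ G∘F _ i ⟨
      G (F (S.linearCombination cs vs)) i  ≈⟨ G.F-cong F≈0 i ⟩
      -- The zero vector is written with entries `0# * 0#` so that homogeneity of `G` alone
      -- evaluates it.
      G (λ j → 0# * 0#) i                  ≈⟨ G.*-homo 0# (λ _ → 0#) i ⟩
      0# * G (λ _ → 0#) i                  ≈⟨ zeroˡ _ ⟩
      0#                                   ∎
      where
      F≈0 : ∀ j → F (S.linearCombination cs vs) j ≈ 0# * 0#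
      F≈0 j = trans (F.linearCombination-homo cs vs j)
        (trans (≈0 j) (sym (zeroˡ 0#)))

  hasMultiplicity-map : ∀ {n} {M M′ : S.Matrix n} → Similar M M′ → ∀ {μ k} →
                        S.HasMultiplicity M μ k → S.HasMultiplicity M′ μ k
  hasMultiplicity-map sim mult = record
    { basis        = F ∘ basis
    ; inEigenspace = λ j → inEigenspace-map sim (inEigenspace j)
    ; independent  = λ cs ≈0 →
        independent cs (linearCombination-zero sim cs basis ≈0)
    ; spanning     = λ v v∈ →
        -- The coordinates of `G v` in the old basis are those of `v` in the new one.
        let cs , eq = spanning (G v) (inEigenspace-map (similar-sym sim) v∈) in
        cs , λ i → begin
          S.linearCombination cs (F ∘ basis) i
            ≈⟨ F.linearCombination-homo cs basis i ⟨
          F (S.linearCombination cs basis) i    ≈⟨ F.F-cong eq i ⟩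
          F (G v) i                             ≈⟨ F∘G v i ⟩
          v i                                   ∎
    }
    where
    open Similar sim
    open S.HasMultiplicity mult
    module F = IsLinear F-isLinear

  similar⇒sameSpectrum : ∀ {n} {M M′ : S.Matrix n} → Similar M M′ → S.SameSpectrum M M′
  similar⇒sameSpectrum sim μ k =
    mk⇔ (hasMultiplicity-map sim) (hasMultiplicity-map (similar-sym sim))

-- Commuting permutations and the intertwining identity.

record IsSwitchingAction {A : Set} (φ σ τ : A → A) : Set where
  field
    φ∘φ : ∀ x → φ (φ x) ≡ x
    σ∘τ : ∀ x → σ (τ x) ≡ x
    τ∘σ : ∀ x → τ (σ x) ≡ x
    σ∘φ : ∀ x → σ (φ x) ≡ φ (σ x)
    τ∘φ : ∀ x → τ (φ x) ≡ φ (τ x)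

  -- Exchanging `σ` and `τ` turns Q into its transpose, so one computation yields both inverse laws.
  inverse : IsSwitchingAction φ τ σ
  inverse = record { φ∘φ = φ∘φ ; σ∘τ = τ∘σ ; τ∘σ = σ∘τ ; σ∘φ = τ∘φ ; τ∘φ = σ∘φ }

𝟙 : Bool → ℕ
𝟙 x = if x then 1 else 0

-- The entrywise form of Q A = A′ Q, with the terms of negative sign moved
-- to the other side.
Intertwined : ∀ {A : Set} (φ σ τ : A → A) (a a′ : A → A → Bool) → Set
Intertwined φ σ τ a a′ = ∀ v w →
  𝟙 (a v w) ℕ.+ 𝟙 (a (φ v) w) ℕ.+ 𝟙 (a (σ v) w) ℕ.+ 𝟙 (a′ v (φ (τ w))) ≡
  𝟙 (a′ v w) ℕ.+ 𝟙 (a′ v (φ w)) ℕ.+ 𝟙 (a′ v (τ w)) ℕ.+ 𝟙 (a (φ (σ v)) w)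

-- The matrix Q over a commutative ring containing one half.

module SwitchingMatrix {c ℓ} (R : CommutativeRing c ℓ) (h : CommutativeRing.Carrier R)
  (h+h≈1 : CommutativeRing._≈_ R (CommutativeRing._+_ R h h) (CommutativeRing.1# R))
  where

  open CommutativeRing R
  open import Algebra.Properties.CommutativeMonoid.Sum +-commutativeMonoid
    using (sum; sum-cong-≋; sum-permute)
  open import Algebra.Properties.Semiring.Mult semiring using (×-homo-+)
    renaming (_×_ to _⊗_)
  open import Algebra.Solver.Ring.NaturalCoefficients.Default commutativeSemiring
    using (solve; _:+_; _:*_; _:=_; con)
  open import Relation.Binary.Reasoning.Setoid setoid
  open Similarity R
  private module S = Spectrum R

  private
    -- The solver is one for semirings: ν is a variable to it.
    ν : Carrier
    ν = - 1#

    1+ν≈0 : 1# + ν ≈ 0#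
    1+ν≈0 = -‿inverseʳ 1#

    -- The solver cannot use `1+ν≈0`, so explicit multiples of `1# + ν` are inserted before it is
    -- called and removed afterwards.
    add-null : ∀ x y → x + (1# + ν) * y ≈ x
    add-null x y = trans (+-congˡ (trans (*-congʳ 1+ν≈0) (zeroˡ y))) (+-identityʳ x)

  signedSum : (x y z w : Carrier) → Carrier
  signedSum x y z w = x + y + z + ν * w

  signedHalf : (x y z w : Carrier) → Carrier
  signedHalf x y z w = h * signedSum x y z w

  signedHalf-cong : ∀ {x y z w x′ y′ z′ w′} → x ≈ x′ → y ≈ y′ → z ≈ z′ → w ≈ w′ →
                    signedHalf x y z w ≈ signedHalf x′ y′ z′ w′
  signedHalf-cong p q r s = *-congˡ (+-cong (+-cong (+-cong p q) r) (*-congˡ s))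

  signedHalf-*ˡ : ∀ k x y z w →
    signedHalf (k * x) (k * y) (k * z) (k * w) ≈ k * signedHalf x y z w
  signedHalf-*ˡ k x y z w = solve 7 (λ k h ν x y z w →
    h :* (k :* x :+ k :* y :+ k :* z :+ ν :* (k :* w)) :=
    k :* (h :* (x :+ y :+ z :+ ν :* w))) refl k h ν x y z w

  signedHalf-*ʳ : ∀ k x y z w →
    signedHalf (x * k) (y * k) (z * k) (w * k) ≈ signedHalf x y z w * k
  signedHalf-*ʳ k x y z w = solve 7 (λ k h ν x y z w →
    h :* (x :* k :+ y :* k :+ z :* k :+ ν :* (w :* k)) :=
    h :* (x :+ y :+ z :+ ν :* w) :* k) refl k h ν x y z w

  signedHalf-sum : ∀ {k} (x y z w : Vector Carrier k) →
    signedHalf (sum x) (sum y) (sum z) (sum w) ≈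
    sum (λ j → signedHalf (x j) (y j) (z j) (w j))
  signedHalf-sum {ℕ.zero} x y z w = solve 2 (λ h ν →
    h :* (con 0 :+ con 0 :+ con 0 :+ ν :* con 0) := con 0) refl h ν
  signedHalf-sum {ℕ.suc k} x y z w = trans
    (solve 10 (λ h ν x y z w x′ y′ z′ w′ →
      h :* ((x :+ x′) :+ (y :+ y′) :+ (z :+ z′) :+ ν :* (w :+ w′)) :=
      h :* (x :+ y :+ z :+ ν :* w) :+ h :* (x′ :+ y′ :+ z′ :+ ν :* w′))
      refl h ν (x 0F) (y 0F) (z 0F) (w 0F) _ _ _ _)
    (+-congˡ (signedHalf-sum (x ∘ suc) (y ∘ suc) (z ∘ suc) (w ∘ suc)))

  -- This is one entry of Q Qᵀ x = x. The arguments are the values of a vector at a point and at its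
  -- images under φ, τ, φτ, σ and φσ, in this order. All but the first cancel, and that one is left
  -- with the coefficient (h + h)².
  signedHalf-involutive : ∀ x y z w u v →
    signedHalf (signedHalf x y z w) (signedHalf y x w z)
               (signedHalf u v x y) (signedHalf v u y x) ≈ x
  signedHalf-involutive x y z w u v = begin
    signedHalf (signedHalf x y z w) (signedHalf y x w z)
               (signedHalf u v x y) (signedHalf v u y x)    ≈⟨ add-null _ _ ⟨
    -- The coefficient of `x` is `h * h` times 3 + ν²; the added 1 + ν turns it into 4 + ν (1 + ν).
    _ + (1# + ν) * (h * h * x)
      ≈⟨ solve 8 (λ h ν x y z w u v →
           h :* (h :* (x :+ y :+ z :+ ν :* w) :+ h :* (y :+ x :+ w :+ ν :* z)
             :+ h :* (u :+ v :+ x :+ ν :* y) :+ ν :* (h :* (v :+ u :+ y :+ ν :* x)))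
             :+ (con 1 :+ ν) :* (h :* h :* x) :=
           (h :+ h) :* (h :+ h) :* x
             :+ (con 1 :+ ν) :* (h :* h :* (ν :* x :+ con 2 :* y :+ z :+ w :+ u :+ v)))
           refl h ν x y z w u v ⟩
    (h + h) * (h + h) * x + (1# + ν) * _  ≈⟨ add-null _ _ ⟩
    (h + h) * (h + h) * x   ≈⟨ *-congʳ (*-cong h+h≈1 h+h≈1) ⟩
    1# * 1# * x             ≈⟨ trans (*-congʳ (*-identityˡ 1#)) (*-identityˡ x) ⟩
    x                       ∎

  -- A common summand `s` contributes `s + s + s + ν * s` on either side, which is Q J = J Q
  -- entrywise. The hypothesis has the negative terms moved across; adding `ν * (w + w′)` to both
  -- sides moves them back.
  signedSum-shift : ∀ s {x y z w x′ y′ z′ w′} →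
    x + y + z + w′ ≈ x′ + y′ + z′ + w →
    signedSum (x + s) (y + s) (z + s) (w + s) ≈
    signedSum (x′ + s) (y′ + s) (z′ + s) (w′ + s)
  signedSum-shift s {x} {y} {z} {w} {x′} {y′} {z′} {w′} eq = begin
    signedSum (x + s) (y + s) (z + s) (w + s)             ≈⟨ collect x y z w w′ ⟩
    (x + y + z + w′) + (ν * (w + w′) + (s + s + s + ν * s))
      ≈⟨ +-cong eq (+-congʳ (*-congˡ (+-comm w w′))) ⟩
    (x′ + y′ + z′ + w) + (ν * (w′ + w) + (s + s + s + ν * s))
      ≈⟨ collect x′ y′ z′ w′ w ⟨
    signedSum (x′ + s) (y′ + s) (z′ + s) (w′ + s)         ∎
    where
    collect : ∀ x y z w w′ → signedSum (x + s) (y + s) (z + s) (w + s) ≈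
      (x + y + z + w′) + (ν * (w + w′) + (s + s + s + ν * s))
    collect x y z w w′ = trans (sym (add-null _ w′)) (solve 7 (λ ν x y z w w′ s →
      (x :+ s) :+ (y :+ s) :+ (z :+ s) :+ ν :* (w :+ s) :+ (con 1 :+ ν) :* w′ :=
      (x :+ y :+ z :+ w′) :+ (ν :* (w :+ w′) :+ (s :+ s :+ s :+ ν :* s)))
      refl ν x y z w w′ s)

  -- Transports the four-term identities of `Intertwined` from `ℕ` to the ring.
  ⊗1-sum : ∀ k l m n {x y z w} →
    x ≈ k ⊗ 1# → y ≈ l ⊗ 1# → z ≈ m ⊗ 1# → w ≈ n ⊗ 1# →
    x + y + z + w ≈ (k ℕ.+ l ℕ.+ m ℕ.+ n) ⊗ 1#
  ⊗1-sum k l m n {x} {y} {z} {w} x≈k y≈l z≈m w≈n = begin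
    x + y + z + w
      ≈⟨ +-cong (+-cong (+-cong x≈k y≈l) z≈m) w≈n ⟩
    k ⊗ 1# + l ⊗ 1# + m ⊗ 1# + n ⊗ 1#
      ≈⟨ +-congʳ (+-congʳ (×-homo-+ 1# k l)) ⟨
    (k ℕ.+ l) ⊗ 1# + m ⊗ 1# + n ⊗ 1#  ≈⟨ +-congʳ (×-homo-+ 1# (k ℕ.+ l) m) ⟨
    (k ℕ.+ l ℕ.+ m) ⊗ 1# + n ⊗ 1#     ≈⟨ ×-homo-+ 1# (k ℕ.+ l ℕ.+ m) n ⟨
    (k ℕ.+ l ℕ.+ m ℕ.+ n) ⊗ 1#        ∎

  IsAdjacencyMatrix : ∀ {n} → S.Matrix n → (Fin n → Fin n → Bool) → Set ℓ
  IsAdjacencyMatrix A a = ∀ u v → A u v ≈ 𝟙 (a u v) ⊗ 1#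

  Q : ∀ {n} (φ σ : Fin n → Fin n) → Vector Carrier n → Vector Carrier n
  Q φ σ x v = signedHalf (x v) (x (φ v)) (x (σ v)) (x (φ (σ v)))

  Q-isLinear : ∀ {n} (φ σ : Fin n → Fin n) → IsLinear (Q φ σ)
  Q-isLinear φ σ = record
    { F-cong = λ x≈y v → signedHalf-cong (x≈y _) (x≈y _) (x≈y _) (x≈y _)
    ; *-homo = λ a x v → signedHalf-*ˡ a _ _ _ _
    ; linearCombination-homo = λ cs vs i → trans
        (signedHalf-sum (λ j → cs j * vs j i) _ _ _)
        (sum-cong-≋ λ j → signedHalf-*ˡ (cs j) _ _ _ _)
    }

  -- A permutation matrix has the matrix of the inverse permutation as its transpose: reindex the
  -- sum by `ρ`.
  sum-transpose : ∀ {n} {ρ ρ⁻¹ : Fin n → Fin n} →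
    (∀ v → ρ (ρ⁻¹ v) ≡ v) → (∀ v → ρ⁻¹ (ρ v) ≡ v) → (x y : Vector Carrier n) →
    sum (λ v → y v * x (ρ⁻¹ v)) ≈ sum (λ v → y (ρ v) * x v)
  sum-transpose {ρ = ρ} {ρ⁻¹} inverseˡ inverseʳ x y = trans
    (sum-permute _ (permutation ρ ρ⁻¹ inverseˡ inverseʳ))
    (sum-cong-≋ λ v → *-congˡ (reflexive (cong x (inverseʳ v))))

  module _ {n} {φ σ τ : Fin n → Fin n} (act : IsSwitchingAction φ σ τ) where

    open IsSwitchingAction act

    Q-inverse : ∀ (x : Vector Carrier n) v → Q φ σ (Q φ τ x) v ≈ x v
    Q-inverse x v
      rewrite τ∘φ v | φ∘φ v | φ∘φ (τ v) | τ∘φ (σ v) | φ∘φ (σ v) | τ∘σ v | φ∘φ v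
      = signedHalf-involutive _ _ _ _ _ _

    -- `Q φ τ` is the transpose of `Q φ σ`: the four terms are transposed separately, and φσ has the
    -- inverse φτ because the maps commute.
    Q-adjoint : ∀ (x y : Vector Carrier n) →
      sum (λ v → y v * Q φ σ x v) ≈ sum (λ v → Q φ τ y v * x v)
    Q-adjoint x y = begin
      sum (λ v → y v * Q φ σ x v)
        ≈⟨ sum-cong-≋ (λ v → sym (signedHalf-*ˡ (y v) _ _ _ _)) ⟩
      sum (λ v → signedHalf (y v * x v) (y v * x (φ v))
                            (y v * x (σ v)) (y v * x (φ (σ v))))
        ≈⟨ signedHalf-sum (λ v → y v * x v) _ _ _ ⟨
      signedHalf (sum λ v → y v * x v) (sum λ v → y v * x (φ v))
                 (sum λ v → y v * x (σ v)) (sum λ v → y v * x (φ (σ v)))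
        ≈⟨ signedHalf-cong refl (sum-transpose φ∘φ φ∘φ x y)
             (sum-transpose τ∘σ σ∘τ x y) (sum-transpose φτφσ φσφτ x y) ⟩
      signedHalf (sum λ v → y v * x v) (sum λ v → y (φ v) * x v)
                 (sum λ v → y (τ v) * x v) (sum λ v → y (φ (τ v)) * x v)
        ≈⟨ signedHalf-sum (λ v → y v * x v) _ _ _ ⟩
      sum (λ v → signedHalf (y v * x v) (y (φ v) * x v)
                            (y (τ v) * x v) (y (φ (τ v)) * x v))
        ≈⟨ sum-cong-≋ (λ v → signedHalf-*ʳ (x v) _ _ _ _) ⟩
      sum (λ v → Q φ τ y v * x v)  ∎
      where
      φτφσ : ∀ v → φ (τ (φ (σ v))) ≡ v
      φτφσ v = ≡.trans (cong φ (τ∘φ (σ v))) (≡.trans (φ∘φ _) (τ∘σ v))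
      φσφτ : ∀ v → φ (σ (φ (τ v))) ≡ v
      φσφτ v = ≡.trans (cong φ (σ∘φ (τ v))) (≡.trans (φ∘φ _) (σ∘τ v))

    module _ {M M′ : S.Matrix n}
      (M-M′ : ∀ v w → Q φ σ (λ u → M u w) v ≈ Q φ τ (M′ v) w) where

      -- The hypothesis `M-M′` is Q M = M′ Q entrywise, with Qᵀ applied to a row of M′. As M x is a
      -- combination of the columns of M, Q may be applied to these columns; adjointness then moves
      -- it from the rows of M′ onto x.
      Q-intertwines : ∀ x v → Q φ σ (M S.· x) v ≈ (M′ S.· Q φ σ x) v
      Q-intertwines x v = begin
        Q φ σ (M S.· x) v
          ≈⟨ F-cong (λ u → sum-cong-≋ λ w → *-comm (M u w) (x w)) v ⟩
        Q φ σ (S.linearCombination x (λ w u → M u w)) v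
          ≈⟨ linearCombination-homo x (λ w u → M u w) v ⟩
        sum (λ w → x w * Q φ σ (λ u → M u w) v)
          ≈⟨ sum-cong-≋ (λ w → trans (*-congˡ (M-M′ v w)) (*-comm (x w) _)) ⟩
        sum (λ w → Q φ τ (M′ v) w * x w)  ≈⟨ Q-adjoint x (M′ v) ⟨
        (M′ S.· Q φ σ x) v                ∎
        where open IsLinear (Q-isLinear φ σ)

  module _ {n} {φ σ τ : Fin n → Fin n} (act : IsSwitchingAction φ σ τ)
           {a a′ : Fin n → Fin n → Bool} (a-a′ : Intertwined φ σ τ a a′)
           {A A′ : S.Matrix n} (A≈a : IsAdjacencyMatrix A a)
           (A′≈a′ : IsAdjacencyMatrix A′ a′) where

    -- Once the common factor `h` and the shift `s` are removed, the entrywise condition is `a-a′`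
    -- read in the ring.
    intertwined⇒sameSpectrum : ∀ s →
      S.SameSpectrum (λ u v → A u v + s) (λ u v → A′ u v + s)
    intertwined⇒sameSpectrum s = similar⇒sameSpectrum record
      { F = Q φ σ ; G = Q φ τ
      ; F-isLinear = Q-isLinear φ σ ; G-isLinear = Q-isLinear φ τ
      ; F∘G = Q-inverse act ; G∘F = Q-inverse (IsSwitchingAction.inverse act)
      ; intertwines = Q-intertwines act λ v w → *-congˡ (signedSum-shift s (trans
          (⊗1-sum (𝟙 (a v w)) (𝟙 (a (φ v) w)) (𝟙 (a (σ v) w)) (𝟙 (a′ v (φ (τ w))))
            (A≈a _ _) (A≈a _ _) (A≈a _ _) (A′≈a′ _ _))
          (trans (reflexive (cong (_⊗ 1#) (a-a′ v w))) (sym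
            (⊗1-sum (𝟙 (a′ v w)) (𝟙 (a′ v (φ w))) (𝟙 (a′ v (τ w))) (𝟙 (a (φ (σ v)) w))
              (A′≈a′ _ _) (A′≈a′ _ _) (A′≈a′ _ _) (A≈a _ _))))))
      }

-- Extension of permutations along an injection.

module Extension {m n : ℕ} {f : Fin m → Fin n} (f-injective : Injective _≡_ _≡_ f) where

  abstract

    -- Opaque, so that goals keep the form `extend ρ v` on which later rewrites act.
    extend : (Fin m → Fin m) → Fin n → Fin n
    extend ρ v with any? (λ p → f p ≟ v)
    ... | yes (p , _) = f (ρ p)
    ... | no _        = v

    extend-image : ∀ ρ p → extend ρ (f p) ≡ f (ρ p)
    extend-image ρ p with any? (λ q → f q ≟ f p)
    ... | yes (q , eq) = cong (f ∘ ρ) (f-injective eq)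
    ... | no ¬∃        = contradiction (p , ≡.refl) ¬∃

    extend-fixed : ∀ ρ {v} → (∀ p → f p ≢ v) → extend ρ v ≡ v
    extend-fixed ρ {v} v∉ with any? (λ p → f p ≟ v)
    ... | yes (p , eq) = contradiction eq (v∉ p)
    ... | no _         = ≡.refl

    extend-∘ : ∀ ρ τ v → extend ρ (extend τ v) ≡ extend (ρ ∘ τ) v
    extend-∘ ρ τ v with any? (λ p → f p ≟ v)
    ... | yes (p , _) = extend-image ρ (τ p)
    ... | no ¬∃       = extend-fixed ρ λ p eq → ¬∃ (p , eq)

    extend-cong : ∀ {ρ τ} → ρ ≗ τ → extend ρ ≗ extend τ
    extend-cong ρ≗τ v with any? (λ p → f p ≟ v)
    ... | yes (p , _) = cong f (ρ≗τ p)
    ... | no _        = ≡.refl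

    extend-id : extend id ≗ id
    extend-id v with any? (λ p → f p ≟ v)
    ... | yes (p , eq) = eq
    ... | no _         = ≡.refl

  -- `extend` respects identity and composition, so equations between composites carry over.
  extend-isSwitchingAction : ∀ {φ σ τ} → IsSwitchingAction φ σ τ →
    IsSwitchingAction (extend φ) (extend σ) (extend τ)
  extend-isSwitchingAction {φ} {σ} {τ} act = record
    { φ∘φ = cancel φ∘φ
    ; σ∘τ = cancel σ∘τ
    ; τ∘σ = cancel τ∘σ
    ; σ∘φ = commute σ∘φ
    ; τ∘φ = commute τ∘φ
    }
    where
    open IsSwitchingAction act
    cancel : ∀ {ρ π} → ρ ∘ π ≗ id → extend ρ ∘ extend π ≗ id
    cancel eq v = ≡.trans (extend-∘ _ _ v) (≡.trans (extend-cong eq v) (extend-id v))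
    commute : ∀ {ρ π} → ρ ∘ π ≗ π ∘ ρ → extend ρ ∘ extend π ≗ extend π ∘ extend ρ
    commute eq v =
      ≡.trans (extend-∘ _ _ v) (≡.trans (extend-cong eq v) (≡.sym (extend-∘ _ _ v)))

-- Permutations of six labels, and rows of vertices in D.

-- The labels 0F, 1F, 2F stand for the tᵢ and 3F, 4F, 5F for the bᵢ.
t₆ b₆ : Fin 3 → Fin 6
t₆ i = i ↑ˡ 3
b₆ i = 3 ↑ʳ i

swap next back : Fin 6 → Fin 6
swap 0F = 3F
swap 1F = 4F
swap 2F = 5F
swap 3F = 0F
swap 4F = 1F
swap 5F = 2F
next 0F = 1F
next 1F = 2F
next 2F = 0F
next 3F = 4F
next 4F = 5F
next 5F = 3F
back 0F = 2F
back 1F = 0F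
back 2F = 1F
back 3F = 5F
back 4F = 3F
back 5F = 4F

isSwitchingAction₆ : IsSwitchingAction swap next back
isSwitchingAction₆ = record
  { φ∘φ = from-yes (all? λ p → swap (swap p) ≟ p)
  ; σ∘τ = from-yes (all? λ p → next (back p) ≟ p)
  ; τ∘σ = from-yes (all? λ p → back (next p) ≟ p)
  ; σ∘φ = from-yes (all? λ p → next (swap p) ≟ swap (next p))
  ; τ∘φ = from-yes (all? λ p → back (swap p) ≟ swap (back p))
  }

-- The rows, in Γ and Γ′, of a vertex of D. An `even` vertex has zero or two neighbours in each Cᵢ
-- and keeps them; an `odd` one has exactly one in each, moved by π, which is `back` on labels.
data SwitchedRow (a a′ : Fin 6 → Bool) : Set where
  even : (∀ p → a (swap p) ≡ a p) → (∀ p → a′ p ≡ a p) → SwitchedRow a a′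
  odd  : (∀ p → a (swap p) ≡ not (a p)) → (∀ p → a′ (back p) ≡ a p) →
         SwitchedRow a a′

module _ {a a′ : Fin 6 → Bool} where

  open IsSwitchingAction isSwitchingAction₆

  private
    shifted : (∀ p → a′ (back p) ≡ a p) → ∀ p → a′ p ≡ a (next p)
    shifted eq p = ≡.trans (cong a′ (≡.sym (τ∘σ p))) (eq (next p))

    swapped : (∀ p → a (swap p) ≡ not (a p)) → (∀ p → a′ (back p) ≡ a p) →
              ∀ p → a′ (swap p) ≡ not (a (next p))
    swapped alt eq p =
      ≡.trans (shifted eq (swap p)) (≡.trans (cong a (σ∘φ p)) (alt (next p)))

  -- The block D × C, where the row index is fixed by φ and σ. In the odd case a swapped pair
  -- contributes 1, so both sides equal 1 + 2 `𝟙 (a q)`.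
  switchedRow-D : SwitchedRow a a′ → ∀ q →
    𝟙 (a q) ℕ.+ 𝟙 (a q) ℕ.+ 𝟙 (a q) ℕ.+ 𝟙 (a′ (swap (back q))) ≡
    𝟙 (a′ q) ℕ.+ 𝟙 (a′ (swap q)) ℕ.+ 𝟙 (a′ (back q)) ℕ.+ 𝟙 (a q)
  switchedRow-D (even alt eq) q
    rewrite eq (swap (back q)) | alt (back q) | eq q | eq (swap q) | alt q | eq (back q)
    with a q | a (back q)
  ... | true  | true  = ≡.refl
  ... | true  | false = ≡.refl
  ... | false | true  = ≡.refl
  ... | false | false = ≡.refl
  switchedRow-D (odd alt eq) q
    rewrite swapped alt eq (back q) | σ∘τ q | swapped alt eq q | shifted eq q | eq q
    with a q | a (next q)
  ... | true  | true  = ≡.refl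
  ... | true  | false = ≡.refl
  ... | false | true  = ≡.refl
  ... | false | false = ≡.refl

  -- The block C × D, where the column index is fixed. In the odd case both sides equal 1 + 2
  -- `𝟙 (a (next p))`.
  switchedRow-C : SwitchedRow a a′ → ∀ p →
    𝟙 (a p) ℕ.+ 𝟙 (a (swap p)) ℕ.+ 𝟙 (a (next p)) ℕ.+ 𝟙 (a′ p) ≡
    𝟙 (a′ p) ℕ.+ 𝟙 (a′ p) ℕ.+ 𝟙 (a′ p) ℕ.+ 𝟙 (a (swap (next p)))
  switchedRow-C (even alt eq) p rewrite eq p | alt p | alt (next p)
    with a p | a (next p)
  ... | true  | true  = ≡.refl
  ... | true  | false = ≡.refl
  ... | false | true  = ≡.refl
  ... | false | false = ≡.refl
  switchedRow-C (odd alt eq) p rewrite shifted eq p | alt p | alt (next p)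
    with a p | a (next p)
  ... | true  | true  = ≡.refl
  ... | true  | false = ≡.refl
  ... | false | true  = ≡.refl
  ... | false | false = ≡.refl

-- The two graphs on the six labels.

edge? : ∀ {n} (u w : Fin n) E → Dec (u ─ w ∈ᴱ E)
edge? u w E = ((u , w) ∈? E) ⊎-dec ((w , u) ∈? E)
  where open DecList (Product.≡-dec _≟_ _≟_) using (_∈?_)

does⇔ : ∀ {A : Set} (A? : Dec A) → does A? ≡ true ⇔ A
does⇔ (yes x) = mk⇔ (λ _ → x) (λ _ → ≡.refl)
does⇔ (no ¬x) = mk⇔ (λ ()) (λ x → contradiction x ¬x)

abstract

  -- The finite check `e₆-intertwined` must compute with these tables, so it shares their abstract
  -- block; outside it they stay folded.
  e₆ e₆′ : Fin 6 → Fin 6 → Bool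
  e₆ p q = does (edge? p q (edges t₆ b₆))
  e₆′ p q = does (edge? p q (edges′ t₆ b₆))

  e₆⇔ : ∀ p q → e₆ p q ≡ true ⇔ p ─ q ∈ᴱ edges t₆ b₆
  e₆⇔ p q = does⇔ (edge? p q (edges t₆ b₆))

  e₆′⇔ : ∀ p q → e₆′ p q ≡ true ⇔ p ─ q ∈ᴱ edges′ t₆ b₆
  e₆′⇔ p q = does⇔ (edge? p q (edges′ t₆ b₆))

  e₆-intertwined : Intertwined swap next back e₆ e₆′
  e₆-intertwined = from-yes (intertwined? e₆ e₆′)
    where
    intertwined? : ∀ a a′ → Dec (Intertwined swap next back a a′)
    intertwined? a a′ = all? λ p → all? λ q → _ ℕ.≟ _

edge-map : ∀ {m n} {f : Fin m → Fin n} → Injective _≡_ _≡_ f → ∀ {p q} E →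
           f p ─ f q ∈ᴱ List.map (Product.map f f) E ⇔ p ─ q ∈ᴱ E
edge-map {f = f} f-injective E =
  mk⇔ (Sum.map ∈⁻ ∈⁻) (Sum.map (List.∈-map⁺ _) (List.∈-map⁺ _))
  where
  ∈⁻ : ∀ {p q} → (f p , f q) List.∈ List.map (Product.map f f) E → (p , q) List.∈ E
  ∈⁻ pq∈ with List.∈-map⁻ _ pq∈
  ... | (p , q) , pq∈E , eq
    rewrite f-injective (cong proj₁ eq) | f-injective (cong proj₂ eq) = pq∈E

-- Neighbour counts in a pair and their parity.

∣p∩⁅x⁆∣ : ∀ {n} (p : Subset n) x → ∣ p ∩ ⁅ x ⁆ ∣ ≡ 𝟙 (lookup p x)
∣p∩⁅x⁆∣ {ℕ.suc n} (true ∷ p) zero =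
  cong ℕ.suc (≡.trans (cong ∣_∣ (∩-zeroʳ p)) (∣⊥∣≡0 n))
∣p∩⁅x⁆∣ {ℕ.suc n} (false ∷ p) zero = ≡.trans (cong ∣_∣ (∩-zeroʳ p)) (∣⊥∣≡0 n)
∣p∩⁅x⁆∣ (true ∷ p)  (suc x) = ∣p∩⁅x⁆∣ p x
∣p∩⁅x⁆∣ (false ∷ p) (suc x) = ∣p∩⁅x⁆∣ p x

∣p∩⁅x,y⁆∣ : ∀ {n} (p : Subset n) {x y} → x ≢ y →
            ∣ p ∩ (⁅ x ⁆ ∪ ⁅ y ⁆) ∣ ≡ 𝟙 (lookup p x) ℕ.+ 𝟙 (lookup p y)
∣p∩⁅x,y⁆∣ p {zero} {zero} x≢y = contradiction ≡.refl x≢y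
∣p∩⁅x,y⁆∣ (true ∷ p) {zero} {suc y} _
  rewrite ∪-identityˡ ⁅ y ⁆ = cong ℕ.suc (∣p∩⁅x⁆∣ p y)
∣p∩⁅x,y⁆∣ (false ∷ p) {zero} {suc y} _ rewrite ∪-identityˡ ⁅ y ⁆ = ∣p∩⁅x⁆∣ p y
∣p∩⁅x,y⁆∣ (true ∷ p) {suc x} {zero} _
  rewrite ∪-identityʳ ⁅ x ⁆ | ∣p∩⁅x⁆∣ p x = ℕ.+-comm 1 (𝟙 (lookup p x))
∣p∩⁅x,y⁆∣ (false ∷ p) {suc x} {zero} _
  rewrite ∪-identityʳ ⁅ x ⁆ | ∣p∩⁅x⁆∣ p x = ≡.sym (ℕ.+-identityʳ _)
∣p∩⁅x,y⁆∣ (true ∷ p) {suc x} {suc y} x≢y = ∣p∩⁅x,y⁆∣ p (x≢y ∘ cong suc)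
∣p∩⁅x,y⁆∣ (false ∷ p) {suc x} {suc y} x≢y = ∣p∩⁅x,y⁆∣ p (x≢y ∘ cong suc)

-- On a pair, the count modulo 2 is the exclusive or of the two adjacencies.
same-parity : ∀ x y z w → (𝟙 x ℕ.+ 𝟙 y) ℕ.% 2 ≡ (𝟙 z ℕ.+ 𝟙 w) ℕ.% 2 → x xor y ≡ z xor w
same-parity x y z w eq = 𝟙-injective (≡.trans (≡.sym (%2 x y)) (≡.trans eq (%2 z w)))
  where
  %2 : ∀ x y → (𝟙 x ℕ.+ 𝟙 y) ℕ.% 2 ≡ 𝟙 (x xor y)
  %2 true  true  = ≡.refl
  %2 true  false = ≡.refl
  %2 false true  = ≡.refl
  %2 false false = ≡.refl
  𝟙-injective : ∀ {x y} → 𝟙 x ≡ 𝟙 y → x ≡ y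
  𝟙-injective {true}  {true}  _ = ≡.refl
  𝟙-injective {false} {false} _ = ≡.refl

-- The switching partition in terms of labels.

module _ {n} {Γ : Graph n} (P : SwitchingPartition Γ) where

  open SwitchingPartition P

  vertex : Fin 6 → Fin n
  vertex = [ t , b ]′ ∘ splitAt 3

  t∈C : ∀ i → t i ∈ C i
  t∈C i = subst (t i ∈_) (≡.sym (C≡tb i)) (p⊆p∪q ⁅ b i ⁆ (x∈⁅x⁆ (t i)))

  b∈C : ∀ i → b i ∈ C i
  b∈C i = subst (b i ∈_) (≡.sym (C≡tb i)) (q⊆p∪q ⁅ t i ⁆ ⁅ b i ⁆ (x∈⁅x⁆ (b i)))

  -- Otherwise `C i` would be a singleton, against `∣C∣≡2`.
  t≢b : ∀ i → t i ≢ b i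
  t≢b i t≡b = contradiction (≡.trans (≡.sym (∣C∣≡2 i)) ∣C∣≡1) λ ()
    where
    ∣C∣≡1 : ∣ C i ∣ ≡ 1
    ∣C∣≡1 = ≡.trans (cong ∣_∣ (≡.trans (C≡tb i)
      (≡.trans (cong (λ x → ⁅ t i ⁆ ∪ ⁅ x ⁆) (≡.sym t≡b)) (∪-idem ⁅ t i ⁆))))
      (∣⁅x⁆∣≡1 (t i))

  same-class : ∀ {i j u v} → u ∈ C i → v ∈ C j → u ≡ v → i ≡ j
  same-class u∈ v∈ ≡.refl = C-disjoint u∈ v∈

  [t,b]-injective : ∀ x y → [ t , b ]′ x ≡ [ t , b ]′ y → x ≡ y
  [t,b]-injective (inj₁ i) (inj₁ j) eq = cong inj₁ (same-class (t∈C i) (t∈C j) eq)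
  [t,b]-injective (inj₂ i) (inj₂ j) eq = cong inj₂ (same-class (b∈C i) (b∈C j) eq)
  [t,b]-injective (inj₁ i) (inj₂ j) eq
    with ≡.refl ← same-class (t∈C i) (b∈C j) eq = contradiction eq (t≢b i)
  [t,b]-injective (inj₂ i) (inj₁ j) eq
    with ≡.refl ← same-class (b∈C i) (t∈C j) eq = contradiction (≡.sym eq) (t≢b i)

  vertex-injective : Injective _≡_ _≡_ vertex
  vertex-injective {p} {q} eq =
    ≡.trans (≡.sym (join-splitAt 3 3 p)) (≡.trans
      (cong (join 3 3) ([t,b]-injective (splitAt 3 p) (splitAt 3 q) eq))
      (join-splitAt 3 3 q))

  vertex∈C : ∀ p → C₁∪C₂∪C₃ (vertex p)
  vertex∈C p with splitAt 3 p
  ... | inj₁ i = i , t∈C i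
  ... | inj₂ i = i , b∈C i

  D⇒vertex≢ : ∀ {v} → v ∈ D → ∀ p → vertex p ≢ v
  D⇒vertex≢ v∈D p ≡.refl = D-disjoint (proj₂ (vertex∈C p)) v∈D

  vertex-cover : ∀ v → (∃ λ p → v ≡ vertex p) ⊎ v ∈ D
  vertex-cover v with cover v
  ... | inj₂ v∈D = inj₂ v∈D
  ... | inj₁ (i , v∈C) with x∈p∪q⁻ ⁅ t i ⁆ ⁅ b i ⁆ (subst (v ∈_) (C≡tb i) v∈C)
  ...   | inj₁ v∈t = inj₁ (i ↑ˡ 3 , ≡.trans (x∈⁅y⁆⇒x≡y _ v∈t) (vertex-t i))
    where
    vertex-t : ∀ i → t i ≡ vertex (t₆ i)
    vertex-t 0F = ≡.refl
    vertex-t 1F = ≡.refl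
    vertex-t 2F = ≡.refl
  ...   | inj₂ v∈b = inj₁ (3 ↑ʳ i , ≡.trans (x∈⁅y⁆⇒x≡y _ v∈b) (vertex-b i))
    where
    vertex-b : ∀ i → b i ≡ vertex (b₆ i)
    vertex-b 0F = ≡.refl
    vertex-b 1F = ≡.refl
    vertex-b 2F = ≡.refl

  open Extension {f = vertex} vertex-injective

  extend-D : ∀ {v} → v ∈ D → ∀ ρ → extend ρ v ≡ v
  extend-D v∈D ρ = extend-fixed ρ (D⇒vertex≢ v∈D)

  numNeighbours≡ : ∀ v i → numNeighbours v i ≡ 𝟙 (adj Γ v (t i)) ℕ.+ 𝟙 (adj Γ v (b i))
  numNeighbours≡ v i = ≡.trans
    (≡.trans (cong (λ c → ∣ neighbours Γ v ∩ c ∣) (C≡tb i))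
      (∣p∩⁅x,y⁆∣ (neighbours Γ v) (t≢b i)))
    (cong₂ (λ x y → 𝟙 x ℕ.+ 𝟙 y)
      (lookup∘tabulate (adj Γ v) (t i)) (lookup∘tabulate (adj Γ v) (b i)))

  module _ {Γ′ : Graph n} (S : IsSwitching P Γ′) where

    open IsSwitching S

    -- `edges t b` is, by computation, the image of `edges t₆ b₆` under `vertex`, so `induced` can
    -- be pulled back to labels.
    adj-vertex : ∀ p q → adj Γ (vertex p) (vertex q) ≡ e₆ p q
    adj-vertex p q = Bool.⇔→≡ (⇔-sym (e₆⇔ p q) ⇔-∘
      (edge-map vertex-injective (edges t₆ b₆) ⇔-∘ induced (vertex∈C p) (vertex∈C q)))

    adj′-vertex : ∀ p q → adj Γ′ (vertex p) (vertex q) ≡ e₆′ p q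
    adj′-vertex p q = Bool.⇔→≡ (⇔-sym (e₆′⇔ p q) ⇔-∘
      (edge-map vertex-injective (edges′ t₆ b₆) ⇔-∘ induced′ (vertex∈C p) (vertex∈C q)))

    -- By `parity` the exclusive or of the adjacencies to tᵢ and bᵢ does not depend on i; its common
    -- value selects the case.
    switchedRow : ∀ {v} → v ∈ D → SwitchedRow (adj Γ v ∘ vertex) (adj Γ′ v ∘ vertex)
    switchedRow {v} v∈D = by-parity _ λ i →
      same-parity (adj Γ v (t i)) (adj Γ v (b i)) (adj Γ v (t 0F)) (adj Γ v (b 0F))
      (≡.trans (cong (ℕ._% 2) (≡.sym (numNeighbours≡ v i)))
        (≡.trans (parity v∈D i 0F) (cong (ℕ._% 2) (numNeighbours≡ v 0F))))
      where
      equal : ∀ {x y} → x xor y ≡ false → x ≡ y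
      equal {true}  {true}  _ = ≡.refl
      equal {false} {false} _ = ≡.refl

      opposite : ∀ {x y} → x xor y ≡ true → y ≡ not x
      opposite {true}  {false} _ = ≡.refl
      opposite {false} {true}  _ = ≡.refl

      by-parity : ∀ z → (∀ i → adj Γ v (t i) xor adj Γ v (b i) ≡ z) →
                  SwitchedRow (adj Γ v ∘ vertex) (adj Γ′ v ∘ vertex)
      by-parity false xor≡ = even pairs λ p → unchanged v∈D ¬one (vertex∈C p)
        where
        pairs : ∀ p → adj Γ v (vertex (swap p)) ≡ adj Γ v (vertex p)
        pairs 0F = ≡.sym (equal (xor≡ 0F))
        pairs 1F = ≡.sym (equal (xor≡ 1F))
        pairs 2F = ≡.sym (equal (xor≡ 2F))
        pairs 3F = equal (xor≡ 0F)
        pairs 4F = equal (xor≡ 1F)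
        pairs 5F = equal (xor≡ 2F)
        -- One class suffices: its count is zero or two.
        ¬one : ¬ OneNeighbourInEach v
        ¬one one with adj Γ v (t 0F) | adj Γ v (b 0F) | xor≡ 0F
                    | ≡.trans (≡.sym (numNeighbours≡ v 0F)) (one 0F)
        ... | true  | true  | _ | ()
        ... | false | false | _ | ()
      -- `vertex (back p)` computes to `t (prev i)` or `b (prev i)` at each label, as `permuted`
      -- requires.
      by-parity true xor≡ = odd pairs λ
        { 0F → proj₁ (permuted v∈D one 0F)
        ; 1F → proj₁ (permuted v∈D one 1F)
        ; 2F → proj₁ (permuted v∈D one 2F)
        ; 3F → proj₂ (permuted v∈D one 0F)
        ; 4F → proj₂ (permuted v∈D one 1F)
        ; 5F → proj₂ (permuted v∈D one 2F)
        }
        where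
        opposite′ : ∀ {x y} → x xor y ≡ true → x ≡ not y
        opposite′ {x} {y} eq = opposite (≡.trans (Bool.xor-comm y x) eq)
        pairs : ∀ p → adj Γ v (vertex (swap p)) ≡ not (adj Γ v (vertex p))
        pairs 0F = opposite (xor≡ 0F)
        pairs 1F = opposite (xor≡ 1F)
        pairs 2F = opposite (xor≡ 2F)
        pairs 3F = opposite′ (xor≡ 0F)
        pairs 4F = opposite′ (xor≡ 1F)
        pairs 5F = opposite′ (xor≡ 2F)
        count : ∀ x y → x xor y ≡ true → 𝟙 x ℕ.+ 𝟙 y ≡ 1
        count true  false _ = ≡.refl
        count false true  _ = ≡.refl
        one : OneNeighbourInEach v
        one i = ≡.trans (numNeighbours≡ v i)
          (count (adj Γ v (t i)) (adj Γ v (b i)) (xor≡ i))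

    -- There is one case per block: C × C is the finite check, the mixed blocks use the row of the
    -- vertex in D, and on D × D all eight terms agree.
    switching-intertwined :
      Intertwined (extend swap) (extend next) (extend back) (adj Γ) (adj Γ′)
    switching-intertwined v w with vertex-cover v | vertex-cover w
    ... | inj₁ (p , ≡.refl) | inj₁ (q , ≡.refl)
      rewrite extend-image swap p | extend-image next p | extend-image swap (next p)
            | extend-image swap q | extend-image back q | extend-image swap (back q)
            | adj-vertex p q | adj-vertex (swap p) q | adj-vertex (next p) q
            | adj-vertex (swap (next p)) q
            | adj′-vertex p q | adj′-vertex p (swap q) | adj′-vertex p (back q)
            | adj′-vertex p (swap (back q))
            = e₆-intertwined p q
    ... | inj₁ (p , ≡.refl) | inj₂ w∈D
      rewrite extend-image swap p | extend-image next p | extend-image swap (next p)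
            | extend-D w∈D back | extend-D w∈D swap
            -- Symmetry of both graphs turns the column of `w` into its row.
            | symm Γ (vertex p) w | symm Γ (vertex (swap p)) w
            | symm Γ (vertex (next p)) w | symm Γ (vertex (swap (next p))) w
            | symm Γ′ (vertex p) w
            = switchedRow-C (switchedRow w∈D) p
    ... | inj₂ v∈D | inj₁ (q , ≡.refl)
      rewrite extend-image swap q | extend-image back q | extend-image swap (back q)
            | extend-D v∈D next | extend-D v∈D swap
            = switchedRow-D (switchedRow v∈D) q
    ... | inj₂ v∈D | inj₂ w∈D
      rewrite extend-D v∈D next | extend-D v∈D swap
            | extend-D w∈D back | extend-D w∈D swap | within-D v∈D w∈D
            = ≡.refl

-- Specialisation to the real numbers.

½ℝ+½ℝ≈1ℝ : fromℚ ½ +ℝ fromℚ ½ ≈ℝ 1ℝ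
-- The sequences are constant and their difference evaluates to zero, so the index 0 works for every
-- ε.
½ℝ+½ℝ≈1ℝ = mk≈ λ ε 0<ε → 0 , λ _ _ → 0<ε

open SwitchingMatrix ℝ-commutativeRing (fromℚ ½) ½ℝ+½ℝ≈1ℝ

isAdjacencyMatrix : ∀ {n} (Γ : Graph n) → IsAdjacencyMatrix (adjacencyMatrix Γ) (adj Γ)
isAdjacencyMatrix Γ u v with adj Γ u v
-- The multiple `1 ⊗ 1#` unfolds to `1# + 0#`.
... | true  = sym (+-identityʳ 1ℝ)
  where open CommutativeRing ℝ-commutativeRing
... | false = CommutativeRing.refl ℝ-commutativeRing

theorem20 : ∀ {n : ℕ} (Γ : Graph n) (P : SwitchingPartition Γ) (Γ′ : Graph n) →
    IsSwitching P Γ′ → RCospectral Γ Γ′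
theorem20 Γ P Γ′ S r =
  intertwined⇒sameSpectrum
    (extend-isSwitchingAction isSwitchingAction₆)
    {a = adj Γ} {a′ = adj Γ′} (switching-intertwined P S)
    {A = adjacencyMatrix Γ} {A′ = adjacencyMatrix Γ′}
    -- The constant `r *ℝ 1ℝ` is the common entry of rJ.
    (isAdjacencyMatrix Γ) (isAdjacencyMatrix Γ′) (r *ℝ 1ℝ)
  where open Extension {f = vertex P} (vertex-injective P)
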